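{- For every integer $n\geqslant 6$, the number of partitions of $n$ with no parts equal to $1$, at most one part equal to $2$, and the largest part occurring more than once equals $\nabla^2[p](n)-\nabla^2[p](n-4)$, and $$\nabla^2 [p](n)-\nabla^2 [p](n-4)=-\sum_{k=5}^{n+5} S^{(5)}_{n+5,k}\, \mu(k).$$
   Context: $p(m)$ denotes the number of partitions of the non-negative integer $m$ (with $p(0)=1$). The $N$th order backward difference of a function $f$ is $\nabla^N[f](x)=\sum_{k=0}^N(-1)^k\binom{N}{k}f(x-k)$, so $\nabla^2[p](m)=p(m)-2p(m-1)+p(m-2)$. $\mu$ is the classical Möbius function on positive integers: $\mu(m)=0$ if $m$ is divisible by the square of a prime, and $\mu(m)=(-1)^s$ if $m$ is a product of $s\geqslant 0$ distinct primes. For integers $r\geqslant 1$, $k\geqslant 1$, $m\geqslant 0$, $S^{(r)}_{m,k}$ denotes the number of $k$'s in the partitions of $m$ with smallest part at least $r$, i.e. the total number of occurrences (with multiplicity) of the part $k$ summed over all partitions of $m$ all of whose parts are $\geqslant r$. -}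

module Defs where

open import Data.Integer using (ℤ; +_; 0ℤ; -1ℤ)
import Data.Integer as ℤ
open import Data.List using (List; []; _∷_; length; map; concatMap; filter; foldr; upTo)
open import Data.List.Extrema.Nat using (max)
open import Data.List.Membership.Propositional using (_∈_; find; lose)
open import Data.List.Membership.Propositional.Properties
  using (∈-map⁺; ∈-map⁻; ∈-upTo⁺; ∈-upTo⁻; ∈-concatMap⁺; ∈-concatMap⁻)
open import Data.List.Properties using (∷-injectiveˡ; ∷-injectiveʳ)
open import Data.List.Relation.Binary.Disjoint.Propositional using (Disjoint)
open import Data.List.Relation.Unary.All using (All; []; _∷_; all?; universal)
import Data.List.Relation.Unary.All.Properties as All
open import Data.List.Relation.Unary.AllPairs using ([]; _∷_)
import Data.List.Relation.Unary.AllPairs as AllPairs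
import Data.List.Relation.Unary.AllPairs.Properties as AllPairs
open import Data.List.Relation.Unary.Any using (here)
open import Data.List.Relation.Unary.Linked using (Linked; []; [-]; _∷_)
open import Data.List.Relation.Unary.Unique.Propositional using (Unique)
import Data.List.Relation.Unary.Unique.Propositional.Properties as Unique
open import Data.Nat
  using ( ℕ; zero; suc; _+_; _∸_; _⊓_; _^_; _≤_; _>_; _≥_; z≤n; s≤s
        ; _≟_; _≤?_; _>?_; NonZero)
open import Data.Nat.Combinatorics using (_C_)
open import Data.Nat.Divisibility using (_∣_; _∣?_; ∣⇒≤; ∣-trans; m∣m*n)
open import Data.Nat.ListAction using (sum)
open import Data.Nat.Primality using (Prime; prime?)
open import Data.Nat.Primality.Factorisation using (factorise; factors)
open import Data.Nat.Properties
open import Data.Product using (∃; _×_; _,_)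
open import Function using (_∘_; _⇔_; mk⇔)
open import Relation.Binary.PropositionalEquality using (_≡_; _≢_; refl; trans; sym; cong)
open import Relation.Nullary using (Dec; yes; no)
open import Relation.Nullary.Decidable using (_×-dec_; map′)

record IsPartition (n : ℕ) (xs : List ℕ) : Set where
  constructor isPartition
  field
    decreasing : Linked _≥_ xs
    positive   : All (1 ≤_) xs
    total      : sum xs ≡ n

-- The partitions of n with at most ℓ parts, all of them at most b; the
-- largest part is suc i.
boundedPartitions : (ℓ b n : ℕ) → List (List ℕ)
boundedPartitions ℓ       b zero    = [] ∷ []
boundedPartitions zero    b (suc n) = []
boundedPartitions (suc ℓ) b (suc n) =
  concatMap (λ i → map (suc i ∷_) (boundedPartitions ℓ (suc i) (n ∸ i)))
            (upTo (b ⊓ suc n))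

-- Each partition of n occurs exactly once in this list (∈-partitions and
-- partitions-unique), so counting list entries counts partitions.
partitions : ℕ → List (List ℕ)
partitions n = boundedPartitions n n n

private
  bounded⁻ : ∀ ℓ b n {xs} → xs ∈ boundedPartitions ℓ b n →
             Linked _≥_ (b ∷ xs) × All (1 ≤_) xs × sum xs ≡ n
  bounded⁻ zero    b zero    (here refl) = [-] , [] , refl
  bounded⁻ (suc ℓ) b zero    (here refl) = [-] , [] , refl
  bounded⁻ (suc ℓ) b (suc n) xs∈
    with i , i∈ , xs∈′ ← find (∈-concatMap⁻ _ {xs = upTo (b ⊓ suc n)} xs∈)
    with ys , ys∈ , refl ← ∈-map⁻ (suc i ∷_) xs∈′
    with lk , pos , tot ← bounded⁻ ℓ (suc i) (n ∸ i) ys∈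
    = ≤-trans (∈-upTo⁻ i∈) (m⊓n≤m b (suc n)) ∷ lk
    , s≤s z≤n ∷ pos
    , trans (cong (_+_ (suc i)) tot)
            (m+[n∸m]≡n (≤-trans (∈-upTo⁻ i∈) (m⊓n≤n b (suc n))))

  bounded⁺ : ∀ ℓ b n {xs} → n ≤ ℓ → Linked _≥_ (b ∷ xs) → All (1 ≤_) xs →
             sum xs ≡ n → xs ∈ boundedPartitions ℓ b n
  bounded⁺ zero    b zero {[]} _ _ _ _ = here refl
  bounded⁺ (suc ℓ) b zero {[]} _ _ _ _ = here refl
  bounded⁺ _ _ zero {zero  ∷ _} _ _ (() ∷ _) _
  bounded⁺ _ _ zero {suc _ ∷ _} _ _ _ ()
  bounded⁺ (suc ℓ) b (suc n) {zero  ∷ xs} _ _ (() ∷ _) _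
  bounded⁺ (suc ℓ) b (suc n) {suc i ∷ xs} (s≤s n≤ℓ) (i<b ∷ lk) (_ ∷ pos) tot
    with refl ← suc-injective tot =
    ∈-concatMap⁺ _ (lose (∈-upTo⁺ (⊓-glb i<b (s≤s (m≤m+n i (sum xs)))))
      (∈-map⁺ (suc i ∷_)
        (bounded⁺ ℓ (suc i) _ (≤-trans (m∸n≤m _ i) n≤ℓ) lk pos
          (sym (m+n∸m≡n i (sum xs))))))

  bounded-unique : ∀ ℓ b n → Unique (boundedPartitions ℓ b n)
  bounded-unique zero    b zero    = [] ∷ []
  bounded-unique (suc ℓ) b zero    = [] ∷ []
  bounded-unique zero    b (suc n) = []
  bounded-unique (suc ℓ) b (suc n) =
    Unique.concat⁺
      (All.map⁺ (universal
        (λ i → Unique.map⁺ ∷-injectiveʳ (bounded-unique ℓ (suc i) (n ∸ i))) _))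
      (AllPairs.map⁺ (AllPairs.map disjoint (Unique.upTo⁺ (b ⊓ suc n))))
    where
    disjoint : ∀ {i j xss yss} → i ≢ j →
               Disjoint (map (suc i ∷_) xss) (map (suc j ∷_) yss)
    disjoint i≢j (p , q)
      with _ , _ , refl ← ∈-map⁻ _ p
      with _ , _ , eq   ← ∈-map⁻ _ q
      = i≢j (suc-injective (∷-injectiveˡ eq))

∈-partitions : ∀ {n xs} → xs ∈ partitions n ⇔ IsPartition n xs
∈-partitions {n} = mk⇔ to from
  where
  tail : ∀ {b xs} → Linked _≥_ (b ∷ xs) → Linked _≥_ xs
  tail [-]      = []
  tail (_ ∷ lk) = lk

  to : ∀ {xs} → xs ∈ partitions n → IsPartition n xs
  to xs∈ with lk , pos , tot ← bounded⁻ n n n xs∈ = isPartition (tail lk) pos tot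

  from : ∀ {xs} → IsPartition n xs → xs ∈ partitions n
  from {[]}     (isPartition _  pos tot)  = bounded⁺ n n n ≤-refl [-] pos tot
  from {x ∷ xs} (isPartition lk pos refl) =
    bounded⁺ n n n ≤-refl (m≤m+n x (sum xs) ∷ lk) pos refl

partitions-unique : ∀ n → Unique (partitions n)
partitions-unique n = bounded-unique n n n

p : ℕ → ℕ
p m = length (partitions m)

mult : ℕ → List ℕ → ℕ
mult k xs = length (filter (_≟ k) xs)

-- The default 0 in max is only used for the empty partition, where
-- mult 0 [] = 0.
RepeatedLargest : List ℕ → Set
RepeatedLargest xs = mult (max 0 xs) xs > 1

Admissible : List ℕ → Set
Admissible xs = mult 1 xs ≡ 0 × mult 2 xs ≤ 1 × RepeatedLargest xs

admissible? : ∀ xs → Dec (Admissible xs)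
admissible? xs =
  (mult 1 xs ≟ 0) ×-dec (mult 2 xs ≤? 1) ×-dec (mult (max 0 xs) xs >? 1)

#admissible : ℕ → ℕ
#admissible n = length (filter admissible? (partitions n))

S : (r m k : ℕ) → ℕ
S r m k = sum (map (mult k) (filter (all? (r ≤?_)) (partitions m)))

∑[_⋯_] : ℕ → ℕ → (ℕ → ℤ) → ℤ
∑[ a ⋯ b ] f = foldr ℤ._+_ 0ℤ (map (λ i → f (a + i)) (upTo (suc b ∸ a)))

-- Since f is only defined on ℕ, this is the backward difference only when
-- N ≤ x; otherwise x ∸ k is truncated at 0.
∇ : ℕ → (ℕ → ℤ) → ℕ → ℤ
∇ N f x = ∑[ 0 ⋯ N ] (λ k → (-1ℤ ℤ.^ k) ℤ.* (+ (N C k)) ℤ.* f (x ∸ k))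

HasPrimeSquareDivisor : ℕ → Set
HasPrimeSquareDivisor m = ∃ λ q → Prime q × q ^ 2 ∣ m

hasPrimeSquareDivisor? : ∀ m .{{_ : NonZero m}} → Dec (HasPrimeSquareDivisor m)
hasPrimeSquareDivisor? m =
  map′ (λ (q , _ , h) → q , h)
       (λ (q , pr , d) → q , s≤s (∣⇒≤ (∣-trans (m∣m*n (q ^ 1)) d)) , pr , d)
       (anyUpTo? (λ q → prime? q ×-dec (q ^ 2 ∣? m)) (suc m))

-- The value at 0 is a dummy.
μ : ℕ → ℤ
μ zero      = 0ℤ
μ m@(suc _) with hasPrimeSquareDivisor? m
... | yes _ = 0ℤ
... | no  _ = -1ℤ ℤ.^ length (factors (factorise m))

{-# OPTIONS --safe #-}
-- Read all counts as coefficients of power series in q, with P = ∏ 1/(1-q^j).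
--
-- Raising the largest part maps the partitions of n - 1 without 1s and with at most
-- one 2 bijectively onto those of n whose largest part is not repeated. So the
-- admissible partitions are counted by (1-q) times the series of partitions without
-- 1s and with at most one 2, which is (1-q)(1+q²)(1-q)(1-q²) P = (1-q)²(1-q⁴) P.
--
-- The series of S⁽⁵⁾ for the part k ≥ 5 is A q^k/(1-q^k) with A the series of
-- partitions into parts ≥ 5. Since ∑_{k∣d} μ(k) = [d = 1], summing A μ(k) q^k/(1-q^k)
-- over all k ≥ 1 gives A q; the terms k = 1, …, 4 are removed explicitly, which
-- leaves - q⁵ (1-q)²(1-q⁴) P.
module Submission where

open import Defs
open import Data.Nat using (ℕ; _≤_; _+_; _∸_)
open import Data.Integer using (+_; -_; _-_; _*_)
open import Data.Product using (_×_)
open import Relation.Binary.PropositionalEquality using (_≡_)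

import Data.Nat as ℕ
open import Data.Nat
  using (zero; suc; _<_; _≥_; _≤?_; _≟_; _>?_; z≤n; s≤s; NonZero; NonTrivial; _^_;
         >-nonZero⁻¹; nonTrivial⇒nonZero; nonTrivial⇒n>1)
open import Data.Nat.Coprimality using (Coprime; coprime-divisor)
open import Data.Nat.Divisibility
open import Data.Nat.Induction using (<-wellFounded; Acc; acc)
open import Data.Nat.ListAction using (sum)
open import Data.Nat.ListAction.Properties using (sum-↭)
open import Data.Nat.Primality
  using (Prime; prime?; prime⇒irreducible; prime⇒nonZero; ¬prime[1]; euclidsLemma)
open import Data.Nat.Primality.Factorisation
  using (PrimeFactorisation; factors; factorise; factorisationUnique)
import Data.Nat.Properties as ℕ
import Data.Integer as ℤ
open import Data.Integer using (ℤ; 0ℤ; 1ℤ; -1ℤ) renaming (_+_ to infixl 6 _⊕_)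
import Data.Integer.Properties as ℤ
open import Data.Integer.Tactic.RingSolver using (solve-∀)
open import Data.Bool using (if_then_else_)
open import Data.List using (List; []; _∷_; length; map; filter; foldr; applyUpTo; _++_)
open import Data.List.Extrema.Nat using (max; max≈v⁺)
open import Data.List.Membership.Propositional using (_∈_)
open import Data.List.Membership.Propositional.Properties
  using (∈-∃++; ∈-filter⁺; ∈-filter⁻; ∈-map⁺; ∈-map⁻)
open import Data.List.Membership.Propositional.Properties.WithK using (unique∧set⇒bag)
open import Data.List.Properties
  using (filter-all; filter-none; filter-accept; filter-reject; length-map; map-∘; map-upTo)
open import Data.List.Relation.Binary.BagAndSetEquality using (∼bag⇒↭)
open import Data.List.Relation.Binary.Permutation.Propositional
  using (_↭_; ↭-sym; ↭-trans; ↭-reflexive; prep; ↭⇒↭ₛ)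
open import Data.List.Relation.Binary.Permutation.Propositional.Properties
  using (↭-length; All-resp-↭; map⁺; drop-∷; filter-↭) renaming (shift to ↭-shift)
open import Data.List.Relation.Binary.Pointwise using (Pointwise-≡⇒≡)
open import Data.List.Relation.Unary.All as All using (All; []; _∷_; all?)
import Data.List.Relation.Unary.All.Properties as All
open import Data.List.Relation.Unary.Any using (here; there)
open import Data.List.Relation.Unary.Linked using (Linked; []; [-]; _∷_)
open import Data.List.Relation.Unary.Linked.Properties using (Linked⇒All)
open import Data.List.Relation.Unary.Sorted.TotalOrder.Properties using (↗↭↗⇒≋)
open import Data.List.Relation.Unary.Unique.Propositional using (Unique)
import Data.List.Relation.Unary.Unique.Propositional.Properties as Unique
open import Data.Product using (∃; _,_; proj₁; proj₂)
open import Data.Sum using (_⊎_; inj₁; inj₂)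
open import Function using (_∘_; _⇔_; mk⇔; Equivalence)
open import Relation.Binary using (_Respects_; DecTotalOrder)
open import Relation.Binary.Properties.DecTotalOrder ℕ.≤-decTotalOrder using (≥-decTotalOrder)
open import Data.List.Sort.InsertionSort ≥-decTotalOrder using (insert; sort)
open import Data.List.Sort.InsertionSort.Properties ≥-decTotalOrder
  using (insert-↭; insert-↗; sort-↭; sort-↗)
open import Relation.Binary.PropositionalEquality
  using (_≢_; _≗_; refl; sym; trans; cong; cong₂; subst; module ≡-Reasoning)
open import Relation.Nullary using (Dec; yes; no; ¬_; does; contradiction; ¬?)
open import Relation.Nullary.Decidable using (_×-dec_; dec-true; dec-false; does-⇔; from-yes)
open import Relation.Unary using (Decidable)
open Equivalence using (to; from)
open IsPartition

-- Sums and power series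

∑< : ℕ → (ℕ → ℤ) → ℤ
∑< zero    f = 0ℤ
∑< (suc n) f = f 0 ⊕ ∑< n (f ∘ suc)

∑<-cong : ∀ n {f g : ℕ → ℤ} → (∀ i → i < n → f i ≡ g i) → ∑< n f ≡ ∑< n g
∑<-cong zero    f≗g = refl
∑<-cong (suc n) f≗g =
  cong₂ _⊕_ (f≗g 0 (s≤s z≤n)) (∑<-cong n λ i i<n → f≗g (suc i) (s≤s i<n))

∑<-zero : ∀ n {f : ℕ → ℤ} → (∀ i → i < n → f i ≡ 0ℤ) → ∑< n f ≡ 0ℤ
∑<-zero zero    f≗0 = refl
∑<-zero (suc n) f≗0
  rewrite f≗0 0 (s≤s z≤n) | ∑<-zero n (λ i i<n → f≗0 (suc i) (s≤s i<n)) = refl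

∑<-split : ∀ m n f → ∑< (m + n) f ≡ ∑< m f ⊕ ∑< n (λ i → f (m + i))
∑<-split zero    n f = sym (ℤ.+-identityˡ _)
∑<-split (suc m) n f =
  trans (cong (f 0 ⊕_) (∑<-split m n (f ∘ suc))) (sym (ℤ.+-assoc (f 0) _ _))

∑<-last : ∀ n f → ∑< (suc n) f ≡ ∑< n f ⊕ f n
∑<-last zero    f = trans (ℤ.+-identityʳ (f 0)) (sym (ℤ.+-identityˡ (f 0)))
∑<-last (suc n) f =
  trans (cong (f 0 ⊕_) (∑<-last n (f ∘ suc))) (sym (ℤ.+-assoc (f 0) _ _))

∑<-truncate : ∀ {m n} → m ≤ n → ∀ {f} → (∀ i → m ≤ i → f i ≡ 0ℤ) → ∑< n f ≡ ∑< m f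
∑<-truncate {m} {n} m≤n {f} f≗0 = begin
  ∑< n f                                    ≡⟨ cong (λ l → ∑< l f) (ℕ.m+[n∸m]≡n m≤n) ⟨
  ∑< (m + (n ∸ m)) f                        ≡⟨ ∑<-split m (n ∸ m) f ⟩
  ∑< m f ⊕ ∑< (n ∸ m) (λ i → f (m + i))     ≡⟨ cong (∑< m f ⊕_) (∑<-zero (n ∸ m) λ i _ →
                                                 f≗0 (m + i) (ℕ.m≤m+n m i)) ⟩
  ∑< m f ⊕ 0ℤ                               ≡⟨ ℤ.+-identityʳ _ ⟩
  ∑< m f                                    ∎
  where open ≡-Reasoning

∑<-distrib-+ : ∀ n f g → ∑< n (λ i → f i ⊕ g i) ≡ ∑< n f ⊕ ∑< n g
∑<-distrib-+ zero    f g = refl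
∑<-distrib-+ (suc n) f g =
  trans (cong ((f 0 ⊕ g 0) ⊕_) (∑<-distrib-+ n (f ∘ suc) (g ∘ suc)))
        (interchange (f 0) (g 0) _ _)
  where
  interchange : ∀ a b c d → (a ⊕ b) ⊕ (c ⊕ d) ≡ (a ⊕ c) ⊕ (b ⊕ d)
  interchange = solve-∀

*-distribˡ-∑< : ∀ n c f → c * ∑< n f ≡ ∑< n (λ i → c * f i)
*-distribˡ-∑< zero    c f = ℤ.*-zeroʳ c
*-distribˡ-∑< (suc n) c f =
  trans (ℤ.*-distribˡ-+ c (f 0) _) (cong (c * f 0 ⊕_) (*-distribˡ-∑< n c (f ∘ suc)))

∑<-comm : ∀ m n (f : ℕ → ℕ → ℤ) →
          ∑< m (λ i → ∑< n (λ j → f i j)) ≡ ∑< n (λ j → ∑< m (λ i → f i j))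
∑<-comm zero    n f = sym (∑<-zero n λ _ _ → refl)
∑<-comm (suc m) n f =
  trans (cong (∑< n (f 0) ⊕_) (∑<-comm m n (f ∘ suc)))
        (sym (∑<-distrib-+ n (f 0) (λ j → ∑< m (λ i → f (suc i) j))))

-- Indicators of decidable propositions.

⟦_⟧ : ∀ {A : Set} → Dec A → ℤ
⟦ a? ⟧ = if does a? then 1ℤ else 0ℤ

⟦⟧-true : ∀ {A : Set} (a? : Dec A) → A → ⟦ a? ⟧ ≡ 1ℤ
⟦⟧-true a? a = cong (if_then 1ℤ else 0ℤ) (dec-true a? a)

⟦⟧-false : ∀ {A : Set} (a? : Dec A) → ¬ A → ⟦ a? ⟧ ≡ 0ℤ
⟦⟧-false a? ¬a = cong (if_then 1ℤ else 0ℤ) (dec-false a? ¬a)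

⟦⟧-cong : ∀ {A B : Set} (a? : Dec A) (b? : Dec B) → A ⇔ B → ⟦ a? ⟧ ≡ ⟦ b? ⟧
⟦⟧-cong a? b? A⇔B = cong (if_then 1ℤ else 0ℤ) (does-⇔ A⇔B a? b?)

⟦⟧-false-* : ∀ {A : Set} (a? : Dec A) x → ¬ A → ⟦ a? ⟧ * x ≡ 0ℤ
⟦⟧-false-* a? x ¬a = trans (cong (_* x) (⟦⟧-false a? ¬a)) (ℤ.*-zeroˡ x)

⟦⟧-true-* : ∀ {A : Set} (a? : Dec A) x → A → ⟦ a? ⟧ * x ≡ x
⟦⟧-true-* a? x a = trans (cong (_* x) (⟦⟧-true a? a)) (ℤ.*-identityˡ x)

-- Among 1, ..., k the only multiple of k is k itself, at index k - 1; past it, k ∣ k + j exactly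
-- when k ∣ j. This block is peeled off in `geometric-fixpoint` and in `∑<-multiples`.
∑<-multiples-step : ∀ k .{{_ : NonZero k}} m (G : ℕ → ℤ) →
  ∑< (k + m) (λ i → ⟦ k ∣? suc i ⟧ * G (suc i)) ≡
  G k ⊕ ∑< m (λ i → ⟦ k ∣? suc i ⟧ * G (k + suc i))
∑<-multiples-step k@(suc l) m G = begin
  ∑< (k + m) F
    ≡⟨ ∑<-split k m F ⟩
  ∑< k F ⊕ ∑< m (λ i → F (k + i))
    ≡⟨ cong (_⊕ ∑< m (λ i → F (k + i))) (∑<-last l F) ⟩
  (∑< l F ⊕ F l) ⊕ ∑< m (λ i → F (k + i))
    ≡⟨ cong₂ (λ x y → (x ⊕ y) ⊕ ∑< m (λ i → F (k + i)))
         (∑<-zero l λ i i<l → ⟦⟧-false-* (k ∣? suc i) _ λ k∣1+i → ℕ.<⇒≱ i<l (ℕ.≤-pred (∣⇒≤ k∣1+i)))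
         (⟦⟧-true-* (k ∣? k) (G k) ∣-refl) ⟩
  (0ℤ ⊕ G k) ⊕ ∑< m (λ i → F (k + i))
    ≡⟨ cong₂ _⊕_ (ℤ.+-identityˡ (G k)) (∑<-cong m λ i _ → shifted i) ⟩
  G k ⊕ ∑< m (λ i → ⟦ k ∣? suc i ⟧ * G (k + suc i)) ∎
  where
  open ≡-Reasoning
  F : ℕ → ℤ
  F i = ⟦ k ∣? suc i ⟧ * G (suc i)
  shifted : ∀ i → F (k + i) ≡ ⟦ k ∣? suc i ⟧ * G (k + suc i)
  shifted i rewrite sym (ℕ.+-suc k i) =
    cong (_* G (k + suc i)) (⟦⟧-cong (k ∣? (k + suc i)) (k ∣? suc i)
      (mk⇔ (λ d → ∣m+n∣m⇒∣n d ∣-refl) (∣m∣n⇒∣m+n ∣-refl)))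

infixl 6 _⊞_
_⊞_ : (ℕ → ℤ) → (ℕ → ℤ) → ℕ → ℤ
(f ⊞ g) m = f m ⊕ g m

-- A sequence is read as a power series in q: shift k is multiplication by q ^ k,
-- and Δ k is multiplication by 1 - q ^ k.
shift : ℕ → (ℕ → ℤ) → ℕ → ℤ
shift zero    f m       = f m
shift (suc k) f zero    = 0ℤ
shift (suc k) f (suc m) = shift k f m

shift-< : ∀ {k m} f → m < k → shift k f m ≡ 0ℤ
shift-< {suc k} {zero}  f m<k       = refl
shift-< {suc k} {suc m} f (s≤s m<k) = shift-< f m<k

shift-+ : ∀ k f m → shift k f (k + m) ≡ f m
shift-+ zero    f m = refl
shift-+ (suc k) f m = shift-+ k f m

shift-cong : ∀ k {f g} → f ≗ g → shift k f ≗ shift k g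
shift-cong zero    f≗g m       = f≗g m
shift-cong (suc k) f≗g zero    = refl
shift-cong (suc k) f≗g (suc m) = shift-cong k f≗g m

-- Matching on `above` turns m into k + l, the form in which `shift-+` applies.
data Position (k m : ℕ) : Set where
  below : m < k → Position k m
  above : ∀ l → m ≡ k + l → Position k m

position : ∀ k m → Position k m
position k m with ℕ.≤-<-connex k m
... | inj₁ k≤m = above (m ∸ k) (sym (ℕ.m+[n∸m]≡n k≤m))
... | inj₂ m<k = below m<k

shift-unique : ∀ k {f g} → (∀ m → m < k → g m ≡ 0ℤ) → (∀ m → g (k + m) ≡ f m) →
               g ≗ shift k f
shift-unique k {f} g< g+ m with position k m
... | below m<k    = trans (g< m m<k) (sym (shift-< f m<k))
... | above l refl = trans (g+ l) (sym (shift-+ k f l))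

shift-distrib-- : ∀ k f g m → shift k (λ i → f i - g i) m ≡ shift k f m - shift k g m
shift-distrib-- zero    f g m       = refl
shift-distrib-- (suc k) f g zero    = refl
shift-distrib-- (suc k) f g (suc m) = shift-distrib-- k f g m

shift-shift : ∀ j k f → shift j (shift k f) ≗ shift (j + k) f
shift-shift zero    k f m       = refl
shift-shift (suc j) k f zero    = refl
shift-shift (suc j) k f (suc m) = shift-shift j k f m

shift-comm : ∀ j k f → shift j (shift k f) ≗ shift k (shift j f)
shift-comm j k f m = begin
  shift j (shift k f) m ≡⟨ shift-shift j k f m ⟩
  shift (j + k) f m     ≡⟨ cong (λ l → shift l f m) (ℕ.+-comm j k) ⟩
  shift (k + j) f m     ≡⟨ shift-shift k j f m ⟨
  shift k (shift j f) m ∎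
  where open ≡-Reasoning

Δ : ℕ → (ℕ → ℤ) → ℕ → ℤ
Δ k f m = f m - shift k f m

Δ-cong : ∀ k {f g} → f ≗ g → Δ k f ≗ Δ k g
Δ-cong k f≗g m = cong₂ _-_ (f≗g m) (shift-cong k f≗g m)

Δ-comm : ∀ j k f → Δ j (Δ k f) ≗ Δ k (Δ j f)
Δ-comm j k f m
  rewrite shift-distrib-- j f (shift k f) m
        | shift-distrib-- k f (shift j f) m
        | shift-comm j k f m
  = swap (f m) (shift k f m) (shift j f m) (shift k (shift j f) m)
  where
  swap : ∀ a b c d → (a - b) - (c - d) ≡ (a - c) - (b - d)
  swap = solve-∀

-- The equation g = q^k (f + g) characterises f q^k / (1 - q^k) without division: as k > 0, each
-- coefficient of g is determined by an earlier one. Two expressions for this series are compared by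
-- checking the equation for both.
shift-fixpoint-unique : ∀ k .{{_ : NonZero k}} f {g g′} →
  (∀ m → g m ≡ shift k (f ⊞ g) m) →
  (∀ m → g′ m ≡ shift k (f ⊞ g′) m) → g ≗ g′
shift-fixpoint-unique k@(suc _) f {g} {g′} fix fix′ m = go m (<-wellFounded m)
  where
  open ≡-Reasoning
  go : ∀ m → Acc _<_ m → g m ≡ g′ m
  go m (acc rec) with position k m
  ... | below m<k    = trans (trans (fix m) (shift-< (f ⊞ g) m<k)) (sym (trans (fix′ m) (shift-< (f ⊞ g′) m<k)))
  ... | above l refl = begin
    g (k + l)       ≡⟨ trans (fix (k + l)) (shift-+ k (f ⊞ g) l) ⟩
    f l ⊕ g l     ≡⟨ cong (f l ⊕_) (go l (rec (ℕ.m<n+m l (s≤s z≤n)))) ⟩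
    f l ⊕ g′ l    ≡⟨ trans (fix′ (k + l)) (shift-+ k (f ⊞ g′) l) ⟨
    g′ (k + l)      ∎

-- If f = (1 - q^k) h then h = f + q^k h; multiply by q^k.
shift-fixpoint : ∀ k {f h} → f ≗ Δ k h → ∀ m →
  shift k h m ≡ shift k (f ⊞ shift k h) m
shift-fixpoint k {f} {h} f≗Δh = shift-cong k λ i →
  trans (restore (h i) (shift k h i)) (cong (_⊕ shift k h i) (sym (f≗Δh i)))
  where
  restore : ∀ a b → a ≡ (a - b) ⊕ b
  restore = solve-∀

-- The coefficients of f * q ^ k / (1 - q ^ k).
geometric : (ℕ → ℤ) → ℕ → ℕ → ℤ
geometric f k m = ∑< m (λ i → ⟦ k ∣? suc i ⟧ * f (m ∸ suc i))

-- The multiple k itself contributes f m to the coefficient at k + m; the further multiples repeat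
-- the sum for m.
geometric-fixpoint : ∀ k .{{_ : NonZero k}} f m →
  geometric f k m ≡ shift k (f ⊞ geometric f k) m
geometric-fixpoint k f = shift-unique k small step
  where
  small : ∀ m → m < k → geometric f k m ≡ 0ℤ
  small m m<k = ∑<-zero m λ i i<m →
    ⟦⟧-false-* (k ∣? suc i) _ λ k∣1+i → ℕ.<⇒≱ m<k (ℕ.≤-trans (∣⇒≤ k∣1+i) i<m)
  step : ∀ m → geometric f k (k + m) ≡ f m ⊕ geometric f k m
  step m = trans (∑<-multiples-step k m (λ d → f (k + m ∸ d)))
    (cong₂ _⊕_ (cong f (ℕ.m+n∸m≡n k m))
      (∑<-cong m λ i _ → cong (λ d → ⟦ k ∣? suc i ⟧ * f d) (ℕ.[m+n]∸[m+o]≡n∸o k m (suc i))))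

-- Applied to f = (1 - q ^ 4) * ∑ p(m) q ^ m; it expresses that
-- q - q/(1-q) + q²/(1-q²) + q³/(1-q³) = - q⁵ (1-q) / ((1-q²)(1-q³)).
polynomial-identity : ∀ f t →
  Δ 3 (Δ 2 (Δ 1 f)) (6 + t) - shift 1 (Δ 3 (Δ 2 f)) (7 + t)
    ⊕ shift 2 (Δ 3 (Δ 1 f)) (7 + t) ⊕ shift 3 (Δ 2 (Δ 1 f)) (7 + t)
  ≡ - Δ 1 (Δ 1 f) (2 + t)
polynomial-identity f t =
  identity (f t) (f (1 + t)) (f (2 + t)) (f (3 + t)) (f (4 + t)) (f (5 + t)) (f (6 + t))
  where
  identity : ∀ x0 x1 x2 x3 x4 x5 x6 →
    (((x6 - x5) - (x4 - x3)) - ((x3 - x2) - (x1 - x0)))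
      - ((x6 - x4) - (x3 - x1)) ⊕ ((x5 - x4) - (x2 - x1)) ⊕ ((x4 - x3) - (x2 - x1))
    ≡ - ((x2 - x1) - (x1 - x0))
  identity = solve-∀

-- The Möbius function

μ-squareful : ∀ m → HasPrimeSquareDivisor m → μ m ≡ 0ℤ
μ-squareful zero      _ = refl
μ-squareful m@(suc _) h with hasPrimeSquareDivisor? m
... | yes _ = refl
... | no ¬h = contradiction h ¬h

μ-squarefree : ∀ m .{{_ : NonZero m}} → ¬ HasPrimeSquareDivisor m →
               μ m ≡ -1ℤ ℤ.^ length (factors (factorise m))
μ-squarefree m@(suc _) ¬h with hasPrimeSquareDivisor? m
... | yes h = contradiction h ¬h
... | no  _ = refl

prime∤⇒coprime : ∀ {q k} → Prime q → q ∤ k → Coprime k q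
prime∤⇒coprime q-prime q∤k (d∣k , d∣q) with prime⇒irreducible q-prime d∣q
... | inj₁ d≡1  = d≡1
... | inj₂ refl = contradiction d∣k q∤k

prime∣prime⇒≡ : ∀ {p q} → Prime p → Prime q → p ∣ q → p ≡ q
prime∣prime⇒≡ p-prime q-prime p∣q with prime⇒irreducible q-prime p∣q
... | inj₁ refl = contradiction p-prime ¬prime[1]
... | inj₂ p≡q  = p≡q

-- Let r² divide q k. If q were r, cancelling one factor would give q ∣ k. So r² is coprime to q and
-- divides k.
cancel-prime-square : ∀ {q k} → Prime q → q ∤ k →
            HasPrimeSquareDivisor (q ℕ.* k) → HasPrimeSquareDivisor k
cancel-prime-square {q} {k} q-prime q∤k (r , r-prime , r²∣qk) =
  r , r-prime , coprime-divisor coprime r²∣qk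
  where
  instance
    q≢0 : NonZero q
    q≢0 = prime⇒nonZero q-prime
  r²≡rr : r ^ 2 ≡ r ℕ.* r
  r²≡rr = cong (r ℕ.*_) (ℕ.*-identityʳ r)
  coprime : Coprime (r ^ 2) q
  coprime = prime∤⇒coprime q-prime λ q∣r² → q∤k (q∣k (q≡r q∣r²))
    where
    q≡r : q ∣ r ^ 2 → q ≡ r
    q≡r q∣r² with euclidsLemma r r q-prime (subst (q ∣_) r²≡rr q∣r²)
    ... | inj₁ q∣r = prime∣prime⇒≡ q-prime r-prime q∣r
    ... | inj₂ q∣r = prime∣prime⇒≡ q-prime r-prime q∣r
    q∣k : q ≡ r → q ∣ k
    q∣k refl = *-cancelˡ-∣ q (subst (_∣ q ℕ.* k) r²≡rr r²∣qk)

-- Prepending q to the prime factors of k gives a factorisation of q k, and factorisations are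
-- unique up to order.
length-factors-prime-* : ∀ q k .{{_ : NonZero k}} .{{_ : NonZero (q ℕ.* k)}} → Prime q →
  length (factors (factorise (q ℕ.* k))) ≡ suc (length (factors (factorise k)))
length-factors-prime-* q k q-prime = ↭-length (factorisationUnique (factorise (q ℕ.* k)) record
  { factors         = q ∷ factors (factorise k)
  ; isFactorisation = cong (q ℕ.*_) (PrimeFactorisation.isFactorisation (factorise k))
  ; factorsPrime    = q-prime ∷ PrimeFactorisation.factorsPrime (factorise k)
  })

μ-prime-*-∣ : ∀ {q k} → Prime q → q ∣ k → μ (q ℕ.* k) ≡ 0ℤ
μ-prime-*-∣ {q} {k} q-prime q∣k = μ-squareful (q ℕ.* k)
  (q , q-prime , subst (_∣ q ℕ.* k) (cong (q ℕ.*_) (sym (ℕ.*-identityʳ q))) (*-monoʳ-∣ q q∣k))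

μ-prime-*-∤ : ∀ {q k} .{{_ : NonZero k}} → Prime q → q ∤ k → μ (q ℕ.* k) ≡ - μ k
μ-prime-*-∤ {q} {k} q-prime q∤k with hasPrimeSquareDivisor? k
... | yes h@(r , r-prime , r²∣k) = trans
  (μ-squareful (q ℕ.* k) (r , r-prime , ∣n⇒∣m*n q r²∣k))
  (cong -_ (sym (μ-squareful k h)))
... | no ¬h = begin
  μ (q ℕ.* k)
    ≡⟨ μ-squarefree (q ℕ.* k) (¬h ∘ cancel-prime-square q-prime q∤k) ⟩
  -1ℤ ℤ.^ length (factors (factorise (q ℕ.* k)))
    ≡⟨ cong (-1ℤ ℤ.^_) (length-factors-prime-* q k q-prime) ⟩
  -1ℤ * (-1ℤ ℤ.^ length (factors (factorise k)))
    ≡⟨ ℤ.-1*i≡-i _ ⟩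
  - (-1ℤ ℤ.^ length (factors (factorise k)))
    ≡⟨ cong -_ (μ-squarefree k ¬h) ⟨
  - μ k ∎
  where
  open ≡-Reasoning
  instance
    qk≢0 : NonZero (q ℕ.* k)
    qk≢0 = ℕ.m*n≢0 q k {{prime⇒nonZero q-prime}}

∑∣μ : ℕ → ℤ
∑∣μ d = ∑< d (λ i → ⟦ suc i ∣? d ⟧ * μ (suc i))

-- Induction on e in blocks of length q. Each step replaces G by its translate by q, hence the
-- quantification over G.
∑<-multiples : ∀ q .{{_ : NonZero q}} e (G : ℕ → ℤ) →
  ∑< (q ℕ.* e) (λ i → ⟦ q ∣? suc i ⟧ * G (suc i)) ≡ ∑< e (λ j → G (q ℕ.* suc j))
∑<-multiples q zero    G rewrite ℕ.*-zeroʳ q = refl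
∑<-multiples q (suc e) G = begin
  ∑< (q ℕ.* suc e) F                                  ≡⟨ cong (λ n → ∑< n F) (ℕ.*-suc q e) ⟩
  ∑< (q + q ℕ.* e) F                                  ≡⟨ ∑<-multiples-step q (q ℕ.* e) G ⟩
  G q ⊕ ∑< (q ℕ.* e) (λ i → ⟦ q ∣? suc i ⟧ * G (q + suc i))
    ≡⟨ cong₂ _⊕_ (cong G (sym (ℕ.*-identityʳ q))) (∑<-multiples q e (λ d → G (q + d))) ⟩
  G (q ℕ.* 1) ⊕ ∑< e (λ j → G (q + q ℕ.* suc j))
    ≡⟨ cong (G (q ℕ.* 1) ⊕_) (∑<-cong e λ j _ → cong G (sym (ℕ.*-suc q (suc j)))) ⟩
  G (q ℕ.* 1) ⊕ ∑< e (λ j → G (q ℕ.* suc (suc j)))    ∎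
  where
  open ≡-Reasoning
  F : ℕ → ℤ
  F i = ⟦ q ∣? suc i ⟧ * G (suc i)

-- The divisors of q e prime to q cancel, through k ↦ q k, against those divisible by q
-- exactly once.
∑∣μ-prime-* : ∀ q e .{{_ : NonZero e}} → Prime q → ∑∣μ (q ℕ.* e) ≡ 0ℤ
∑∣μ-prime-* q e q-prime = begin
  ∑∣μ (q ℕ.* e)
    ≡⟨ ∑<-cong (q ℕ.* e) (λ i _ → by-q (suc i)) ⟩
  ∑< (q ℕ.* e) (λ i → G (suc i) ⊕ ⟦ q ∣? suc i ⟧ * F (suc i))
    ≡⟨ ∑<-distrib-+ (q ℕ.* e) (G ∘ suc) (λ i → ⟦ q ∣? suc i ⟧ * F (suc i)) ⟩
  ∑< (q ℕ.* e) (G ∘ suc) ⊕ ∑< (q ℕ.* e) (λ i → ⟦ q ∣? suc i ⟧ * F (suc i))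
    -- The sum over `G` stops at e, because no k > e divides e.
    ≡⟨ cong₂ _⊕_
         (∑<-truncate (ℕ.m≤n*m e q) λ i e≤i →
           ⟦⟧-false-* (suc i ∣? e) _ λ 1+i∣e → ℕ.<⇒≱ (s≤s e≤i) (∣⇒≤ 1+i∣e))
         (∑<-multiples q e F) ⟩
  ∑< e (G ∘ suc) ⊕ ∑< e (λ j → F (q ℕ.* suc j))
    ≡⟨ ∑<-distrib-+ e (G ∘ suc) (λ j → F (q ℕ.* suc j)) ⟨
  ∑< e (λ j → G (suc j) ⊕ F (q ℕ.* suc j))
    ≡⟨ ∑<-zero e (λ j _ → cancel (suc j)) ⟩
  0ℤ ∎
  where
  open ≡-Reasoning
  instance
    q≢0 : NonZero q
    q≢0 = prime⇒nonZero q-prime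

  -- `F k` is the summand of `∑∣μ (q ℕ.* e)`, and `G k` is its share from k prime to q; for such k,
  -- dividing q e is the same as dividing e.
  F G : ℕ → ℤ
  F k = ⟦ k ∣? q ℕ.* e ⟧ * μ k
  G k = ⟦ k ∣? e ⟧ * (⟦ ¬? (q ∣? k) ⟧ * μ k)

  by-q : ∀ k → F k ≡ G k ⊕ ⟦ q ∣? k ⟧ * F k
  by-q k with q ∣? k
  ... | yes _  = both ⟦ k ∣? e ⟧ (μ k) (F k)
    where
    both : ∀ a b c → c ≡ a * (0ℤ * b) ⊕ 1ℤ * c
    both = solve-∀
  ... | no q∤k = trans
    (cong (_* μ k) (⟦⟧-cong (k ∣? q ℕ.* e) (k ∣? e)
      (mk⇔ (coprime-divisor (prime∤⇒coprime q-prime q∤k)) (∣n⇒∣m*n q))))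
    (neither ⟦ k ∣? e ⟧ (μ k) (F k))
    where
    neither : ∀ a b c → a * b ≡ a * (1ℤ * b) ⊕ 0ℤ * c
    neither = solve-∀

  cancel : ∀ k .{{_ : NonZero k}} → G k ⊕ F (q ℕ.* k) ≡ 0ℤ
  cancel k = trans (cong (λ x → G k ⊕ x * μ (q ℕ.* k))
    (⟦⟧-cong (q ℕ.* k ∣? q ℕ.* e) (k ∣? e) (mk⇔ (*-cancelˡ-∣ q) (*-monoʳ-∣ q)))) summand
    where
    summand : G k ⊕ ⟦ k ∣? e ⟧ * μ (q ℕ.* k) ≡ 0ℤ
    -- If q ∣ k, then q² ∣ q k and both terms vanish; otherwise μ (q k) = - μ k.
    summand with q ∣? k
    ... | yes q∣k rewrite μ-prime-*-∣ q-prime q∣k = zeros ⟦ k ∣? e ⟧ (μ k)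
      where
      zeros : ∀ a b → a * (0ℤ * b) ⊕ a * 0ℤ ≡ 0ℤ
      zeros = solve-∀
    ... | no q∤k rewrite μ-prime-*-∤ {q} {k} q-prime q∤k = opposite ⟦ k ∣? e ⟧ (μ k)
      where
      opposite : ∀ a b → a * (1ℤ * b) ⊕ a * (- b) ≡ 0ℤ
      opposite = solve-∀

μ[1]≡1 : μ 1 ≡ 1ℤ
μ[1]≡1 = μ-squarefree 1 λ (r , r-prime , r²∣1) →
  ¬prime[1] (subst Prime (ℕ.m*n≡1⇒m≡1 r (r ^ 1) (∣1⇒≡1 r²∣1)) r-prime)

∑∣μ≡0 : ∀ n .{{_ : NonTrivial n}} → ∑∣μ n ≡ 0ℤ
∑∣μ≡0 n {{nt}} with factorise n {{nonTrivial⇒nonZero n}}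
-- The empty product would make n equal to 1.
... | record { factors = [] ; isFactorisation = refl } = contradiction (nonTrivial⇒n>1 1) (ℕ.n≮n 1)
... | record { factors = q ∷ qs ; isFactorisation = refl ; factorsPrime = q-prime ∷ _ } =
  ∑∣μ-prime-* q _ {{ℕ.m*n≢0⇒n≢0 q {{nonTrivial⇒nonZero n}}}} q-prime

-- Partitions

-- Membership in a duplicate-free list has at most one proof, so equality as sets is equality as
-- bags. This turns bijections between partitions into equalities of counts.
unique⇔⇒↭ : ∀ {A : Set} {xs ys : List A} → Unique xs → Unique ys →
            (∀ {z} → z ∈ xs → z ∈ ys) → (∀ {z} → z ∈ ys → z ∈ xs) → xs ↭ ys
unique⇔⇒↭ xs! ys! xs⊆ys ys⊆xs = ∼bag⇒↭ (unique∧set⇒bag xs! ys! (mk⇔ xs⊆ys ys⊆xs))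

module _ {A : Set} {P Q R : A → Set} (P? : Decidable P) (Q? : Decidable Q) (R? : Decidable R) where

  -- The hypotheses are limited to members of `xs`, so that with `partitions m` for `xs` the
  -- positivity of the parts can be used.
  length-filter-⊎ : ∀ xs →
    (∀ {x} → x ∈ xs → R x → P x ⊎ Q x) →
    (∀ {x} → x ∈ xs → P x → R x × ¬ Q x) →
    (∀ {x} → x ∈ xs → Q x → R x) →
    length (filter R? xs) ≡ length (filter P? xs) + length (filter Q? xs)
  length-filter-⊎ []       R⇒P⊎Q P⇒R Q⇒R = refl
  length-filter-⊎ (x ∷ xs) R⇒P⊎Q P⇒R Q⇒R
    with ih ← length-filter-⊎ xs (R⇒P⊎Q ∘ there) (P⇒R ∘ there) (Q⇒R ∘ there)
    with R? x | P? x | Q? x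
  ... | yes r | yes p | yes q = contradiction q (proj₂ (P⇒R (here refl) p))
  ... | yes r | yes p | no ¬q = cong suc ih
  ... | yes r | no ¬p | yes q = trans (cong suc ih) (sym (ℕ.+-suc (length (filter P? xs)) _))
  ... | no ¬r | no ¬p | no ¬q = ih
  ... | no ¬r | yes p | _     = contradiction (proj₁ (P⇒R (here refl) p)) ¬r
  ... | no ¬r | no _  | yes q = contradiction (Q⇒R (here refl) q) ¬r
  ... | yes r | no ¬p | no ¬q with R⇒P⊎Q (here refl) r
  ... | inj₁ p = contradiction p ¬p
  ... | inj₂ q = contradiction q ¬q

module _ {A : Set} {P R : A → Set} (P? : Decidable P) (R? : Decidable R) where

  sum-map-filter : ∀ f xs → (∀ {x} → P x → R x) → (∀ {x} → R x → ¬ P x → f x ≡ 0) →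
                   sum (map f (filter R? xs)) ≡ sum (map f (filter P? xs))
  sum-map-filter f []       P⇒R f≡0 = refl
  sum-map-filter f (x ∷ xs) P⇒R f≡0 with ih ← sum-map-filter f xs P⇒R f≡0 | R? x | P? x
  ... | yes r | yes p = cong (f x ℕ.+_) ih
  ... | yes r | no ¬p = trans (cong (ℕ._+ sum (map f (filter R? xs))) (f≡0 r ¬p)) ih
  ... | no ¬r | yes p = contradiction (P⇒R p) ¬r
  ... | no ¬r | no ¬p = ih

sum-map-suc : ∀ {A : Set} {f g : A → ℕ} → (∀ x → f x ≡ suc (g x)) → ∀ xs →
              sum (map f xs) ≡ length xs + sum (map g xs)
sum-map-suc {f = f} {g} f≗1+g []       = refl
sum-map-suc {f = f} {g} f≗1+g (x ∷ xs) = begin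
  f x + sum (map f xs)                    ≡⟨ cong₂ _+_ (f≗1+g x) (sum-map-suc f≗1+g xs) ⟩
  suc (g x + (length xs + sum (map g xs))) ≡⟨ cong suc (x∙yz≈y∙xz (g x) (length xs) _) ⟩
  suc (length xs + (g x + sum (map g xs))) ∎
  where
  open ≡-Reasoning
  open import Algebra.Properties.CommutativeSemigroup ℕ.+-commutativeSemigroup using (x∙yz≈y∙xz)

mult-≡ : ∀ k xs → mult k (k ∷ xs) ≡ suc (mult k xs)
mult-≡ k xs = cong length (filter-accept (_≟ k) {xs = xs} refl)

mult-≢ : ∀ {k x} xs → x ≢ k → mult k (x ∷ xs) ≡ mult k xs
mult-≢ {k} xs x≢k = cong length (filter-reject (_≟ k) {xs = xs} x≢k)

mult-tail-≤ : ∀ k x xs → mult k xs ≤ mult k (x ∷ xs)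
mult-tail-≤ k x xs with x ≟ k
... | yes refl = ℕ.≤-trans (ℕ.n≤1+n _) (ℕ.≤-reflexive (sym (mult-≡ k xs)))
... | no  x≢k  = ℕ.≤-reflexive (sym (mult-≢ xs x≢k))

mult-resp-↭ : ∀ k {xs ys} → xs ↭ ys → mult k xs ≡ mult k ys
mult-resp-↭ k xs↭ys = ↭-length (filter-↭ (_≟ k) xs↭ys)

mult≡0⇒All≢ : ∀ k xs → mult k xs ≡ 0 → All (_≢ k) xs
mult≡0⇒All≢ k []       _ = []
mult≡0⇒All≢ k (x ∷ xs) h with x ≟ k
... | yes refl = contradiction (trans (sym (mult-≡ k xs)) h) ℕ.1+n≢0
... | no  x≢k  = x≢k ∷ mult≡0⇒All≢ k xs (trans (sym (mult-≢ xs x≢k)) h)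

All≢⇒mult≡0 : ∀ k {xs} → All (_≢ k) xs → mult k xs ≡ 0
All≢⇒mult≡0 k xs≢k = cong length (filter-none (_≟ k) xs≢k)

mult≢0⇒∈ : ∀ k xs → mult k xs ≢ 0 → k ∈ xs
mult≢0⇒∈ k []       h = contradiction refl h
mult≢0⇒∈ k (x ∷ xs) h with x ≟ k
... | yes refl = here refl
... | no  x≢k  = there (mult≢0⇒∈ k xs (h ∘ trans (mult-≢ xs x≢k)))

All≤∧mult≡0⇒All< : ∀ r {xs} → All (r ≤_) xs → mult r xs ≡ 0 → All (suc r ≤_) xs
All≤∧mult≡0⇒All< r {xs} r≤xs h =
  All.zipWith (λ (r≤x , x≢r) → ℕ.≤∧≢⇒< r≤x (x≢r ∘ sym)) (r≤xs , mult≡0⇒All≢ r xs h)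

All<⇒mult≡0 : ∀ r {xs} → All (suc r ≤_) xs → mult r xs ≡ 0
All<⇒mult≡0 r r<xs = All≢⇒mult≡0 r (All.map ℕ.>⇒≢ r<xs)

-- A multiset has only one decreasing arrangement, so partitions can be compared up to permutation.
partition-≡ : ∀ {m n xs ys} → IsPartition m xs → IsPartition n ys → xs ↭ ys → xs ≡ ys
partition-≡ xs-part ys-part xs↭ys = Pointwise-≡⇒≡
  (↗↭↗⇒≋ (DecTotalOrder.totalOrder ≥-decTotalOrder)
    (decreasing xs-part) (decreasing ys-part) (↭⇒↭ₛ xs↭ys))

insert-partition : ∀ {k m ys} → 1 ≤ k → IsPartition m ys → IsPartition (k + m) (insert k ys)
insert-partition {k} {m} {ys} 1≤k (isPartition dec pos tot) = isPartition
  (insert-↗ k dec)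
  (All-resp-↭ (↭-sym (insert-↭ k ys)) (1≤k ∷ pos))
  (trans (sum-↭ (insert-↭ k ys)) (cong (k ℕ.+_) tot))

insert-injective : ∀ {k m n xs ys} → IsPartition m xs → IsPartition n ys →
                   insert k xs ≡ insert k ys → xs ≡ ys
insert-injective {k} {xs = xs} {ys} xs-part ys-part eq = partition-≡ xs-part ys-part
  (drop-∷ (↭-trans (↭-sym (insert-↭ k xs)) (↭-trans (↭-reflexive eq) (insert-↭ k ys))))

remove-part : ∀ {k m xs} → k ∈ xs → IsPartition (k + m) xs →
         ∃ λ ys → IsPartition m ys × xs ↭ k ∷ ys
remove-part {k} {m} {xs} k∈xs (isPartition dec pos tot) with ∈-∃++ k∈xs
-- Sorting what remains makes it decreasing at once, and as a permutation it keeps the sum and the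
-- positivity.
... | us , vs , refl = sort zs , isPartition (sort-↗ zs) (All-resp-↭ (↭-sym (sort-↭ zs)) zs-pos)
                         (trans (sum-↭ (sort-↭ zs)) zs-tot)
                     , ↭-trans xs↭ (prep k (↭-sym (sort-↭ zs)))
  where
  zs = us ++ vs
  xs↭ : us ++ k ∷ vs ↭ k ∷ zs
  xs↭ = ↭-shift k us vs
  zs-pos : All (1 ≤_) zs
  zs-pos = All.tail (All-resp-↭ xs↭ pos)
  zs-tot : sum zs ≡ m
  zs-tot = ℕ.+-cancelˡ-≡ k _ _ (trans (sym (sum-↭ xs↭)) tot)

-- Injectivity is asked on partitions only, which is what `insert-injective` provides.
Unique-map-partitions : ∀ {m} {Q : List ℕ → Set} (Q? : Decidable Q) (f : List ℕ → List ℕ) →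
  (∀ {xs ys} → IsPartition m xs → IsPartition m ys → f xs ≡ f ys → xs ≡ ys) →
  Unique (map f (filter Q? (partitions m)))
Unique-map-partitions {m} Q? f inj = go (filter Q? (partitions m))
  (All.tabulate (to ∈-partitions ∘ proj₁ ∘ ∈-filter⁻ Q? {xs = partitions m}))
  (Unique.filter⁺ Q? (partitions-unique m))
  where
  open import Data.List.Relation.Unary.AllPairs using ([]; _∷_)
  go : ∀ xss → All (IsPartition m) xss → Unique xss → Unique (map f xss)
  go []         _        _              = []
  go (xs ∷ xss) (p ∷ ps) (xs∉xss ∷ xss!) =
    All.map⁺ (All.zipWith (λ (q , xs≢ys) eq → xs≢ys (inj p q eq)) (ps , xs∉xss)) ∷ go xss ps xss!

-- Counting functions and removal of a part.

count : {P : List ℕ → Set} → Decidable P → ℕ → ℤ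
count P? m = + length (filter P? (partitions m))

module _ {P Q : List ℕ → Set} (P? : Decidable P) (Q? : Decidable Q) (k : ℕ) .{{_ : NonZero k}}
         (P-resp-↭ : P Respects _↭_) (P⇒∈ : ∀ {xs} → P xs → k ∈ xs)
         (P∷⇔Q : ∀ {ys} → All (1 ≤_) ys → P (k ∷ ys) ⇔ Q ys) where

  -- Deleting one copy of k and `insert k` are inverse bijections. Since P is invariant under
  -- permutation, that copy can be brought to the front, where P (k ∷ ys) becomes Q ys.
  filter-partitions-↭ : ∀ m →
    filter P? (partitions (k + m)) ↭ map (insert k) (filter Q? (partitions m))
  filter-partitions-↭ m = unique⇔⇒↭
    (Unique.filter⁺ P? (partitions-unique (k + m)))
    (Unique-map-partitions {m} Q? (insert k) insert-injective)
    removed inserted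
    where
    removed : ∀ {xs} → xs ∈ filter P? (partitions (k + m)) →
              xs ∈ map (insert k) (filter Q? (partitions m))
    removed {xs} xs∈ with xs∈ps , Pxs ← ∈-filter⁻ P? {xs = partitions (k + m)} xs∈
      with xs-part ← to ∈-partitions xs∈ps
      with ys , ys-part , xs↭ ← remove-part (P⇒∈ Pxs) xs-part
      = subst (_∈ _) (partition-≡ (insert-partition (>-nonZero⁻¹ k) ys-part) xs-part
                       (↭-trans (insert-↭ k ys) (↭-sym xs↭)))
          (∈-map⁺ (insert k) (∈-filter⁺ Q? (from ∈-partitions ys-part)
            (to (P∷⇔Q (positive ys-part)) (P-resp-↭ xs↭ Pxs))))

    inserted : ∀ {xs} → xs ∈ map (insert k) (filter Q? (partitions m)) →
               xs ∈ filter P? (partitions (k + m))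
    inserted xs∈ with ys , ys∈ , refl ← ∈-map⁻ (insert k) xs∈
      with ys∈ps , Qys ← ∈-filter⁻ Q? {xs = partitions m} ys∈
      with ys-part ← to ∈-partitions ys∈ps
      = ∈-filter⁺ P? (from ∈-partitions (insert-partition (>-nonZero⁻¹ k) ys-part))
          (P-resp-↭ (↭-sym (insert-↭ k ys)) (from (P∷⇔Q (positive ys-part)) Qys))

  filter-partitions-< : ∀ m → m < k → filter P? (partitions m) ≡ []
  filter-partitions-< m m<k = filter-none P? (All.tabulate λ {xs} xs∈ Pxs →
    ℕ.<⇒≱ m<k (subst (k ≤_) (total (to ∈-partitions xs∈)) (∈⇒≤sum (P⇒∈ Pxs))))
    where
    ∈⇒≤sum : ∀ {x xs} → x ∈ xs → x ≤ sum xs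
    ∈⇒≤sum {xs = y ∷ xs} (here refl)  = ℕ.m≤m+n y (sum xs)
    ∈⇒≤sum {xs = y ∷ xs} (there x∈xs) = ℕ.≤-trans (∈⇒≤sum x∈xs) (ℕ.m≤n+m (sum xs) y)

  count-remove : count P? ≗ shift k (count Q?)
  count-remove = shift-unique k
    (λ m m<k → cong (+_ ∘ length) (filter-partitions-< m m<k))
    (λ m → cong +_ (trans (↭-length (filter-partitions-↭ m))
                          (length-map (insert k) (filter Q? (partitions m)))))

-- Partitions with all parts at least r, and the numbers S.

parts≥? : ∀ r → Decidable (All (r ≤_))
parts≥? r = all? (r ≤?_)

count≥ : ℕ → ℕ → ℤ
count≥ r = count (parts≥? r)

module Containing (r k : ℕ) .{{_ : NonZero k}} (r≤k : r ≤ k) where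

  P : List ℕ → Set
  P xs = All (r ≤_) xs × mult k xs ≢ 0

  P? : Decidable P
  P? xs = parts≥? r xs ×-dec ¬? (mult k xs ≟ 0)

  P-resp-↭ : P Respects _↭_
  P-resp-↭ xs↭ys (r≤xs , h) = All-resp-↭ xs↭ys r≤xs , h ∘ trans (mult-resp-↭ k xs↭ys)

  P⇒∈ : ∀ {xs} → P xs → k ∈ xs
  P⇒∈ {xs} (_ , h) = mult≢0⇒∈ k xs h

  P∷⇔ : ∀ {ys} → All (1 ≤_) ys → P (k ∷ ys) ⇔ All (r ≤_) ys
  P∷⇔ {ys} _ = mk⇔ (All.tail ∘ proj₁)
    (λ r≤ys → r≤k ∷ r≤ys , λ h → ℕ.1+n≢0 (trans (sym (mult-≡ k ys)) h))

  count-P : count P? ≗ shift k (count≥ r)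
  count-P = count-remove P? (parts≥? r) k P-resp-↭ P⇒∈ P∷⇔

  S-as-sum : ∀ m → S r m k ≡ sum (map (mult k) (filter P? (partitions m)))
  S-as-sum m = sum-map-filter P? (parts≥? r) (mult k) (partitions m) proj₁ (vanish _)
    where
    vanish : ∀ xs → All (r ≤_) xs → ¬ P xs → mult k xs ≡ 0
    vanish xs r≤xs ¬P with mult k xs ≟ 0
    ... | yes h = h
    ... | no  h = contradiction (r≤xs , h) ¬P

  -- Removing one k from every partition that contains k lowers each multiplicity by one; the number
  -- of partitions involved supplies the term `count≥ r`. This is the equation that
  -- `geometric (count≥ r) k` satisfies.
  S-fixpoint : ∀ m → + S r m k ≡ shift k (count≥ r ⊞ λ j → + S r j k) m
  S-fixpoint = shift-unique k
    (λ m m<k → cong +_ (trans (S-as-sum m) (cong (sum ∘ map (mult k))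
      (filter-partitions-< P? (parts≥? r) k P-resp-↭ P⇒∈ P∷⇔ m m<k))))
    (λ m → cong +_ (step m))
    where
    open ≡-Reasoning
    step : ∀ m → S r (k + m) k ≡ length (filter (parts≥? r) (partitions m)) + S r m k
    step m = begin
      S r (k + m) k
        ≡⟨ S-as-sum (k + m) ⟩
      sum (map (mult k) (filter P? (partitions (k + m))))
        ≡⟨ sum-↭ (map⁺ (mult k) (filter-partitions-↭ P? (parts≥? r) k P-resp-↭ P⇒∈ P∷⇔ m)) ⟩
      sum (map (mult k) (map (insert k) (filter (parts≥? r) (partitions m))))
        ≡⟨ cong sum (map-∘ (filter (parts≥? r) (partitions m))) ⟨
      sum (map (mult k ∘ insert k) (filter (parts≥? r) (partitions m)))
        ≡⟨ sum-map-suc (λ ys → trans (mult-resp-↭ k (insert-↭ k ys)) (mult-≡ k ys))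
                       (filter (parts≥? r) (partitions m)) ⟩
      length (filter (parts≥? r) (partitions m)) + S r m k ∎

-- Among partitions into parts at least r, those that contain r have q^r times the whole series; the
-- others have all parts above r.
count≥-suc : ∀ r .{{_ : NonZero r}} → count≥ (suc r) ≗ Δ r (count≥ r)
count≥-suc r m = begin
  count≥ (suc r) m
    ≡⟨ cancel (count≥ (suc r) m) (count P? m) ⟩
  (count≥ (suc r) m ⊕ count P? m) - count P? m
    ≡⟨ cong₂ _-_ (cong +_ (sym split)) (count-P m) ⟩
  Δ r (count≥ r) m ∎
  where
  open ≡-Reasoning
  open Containing r r ℕ.≤-refl
  cancel : ∀ a b → a ≡ (a ⊕ b) - b
  cancel = solve-∀
  split : length (filter (parts≥? r) (partitions m)) ≡
          length (filter (parts≥? (suc r)) (partitions m)) + length (filter P? (partitions m))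
  split = length-filter-⊎ (parts≥? (suc r)) P? (parts≥? r) (partitions m)
    (λ {xs} _ → cases xs)
    (λ _ r<xs → All.map ℕ.<⇒≤ r<xs , λ (_ , h) → h (All<⇒mult≡0 r r<xs))
    (λ _ → proj₁)
    where
    cases : ∀ xs → All (r ≤_) xs → All (suc r ≤_) xs ⊎ P xs
    cases xs r≤xs with mult r xs ≟ 0
    ... | yes h = inj₁ (All≤∧mult≡0⇒All< r r≤xs h)
    ... | no  h = inj₂ (r≤xs , h)

count≥1 : ∀ m → count≥ 1 m ≡ + p m
count≥1 m = cong (+_ ∘ length) (filter-all (parts≥? 1) {partitions m}
  (All.tabulate (positive ∘ to (∈-partitions {m}))))

-- Partitions without 1s and with at most one 2.

AtMostOneTwo : List ℕ → Set
AtMostOneTwo xs = mult 1 xs ≡ 0 × mult 2 xs ≤ 1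

atMostOneTwo? : Decidable AtMostOneTwo
atMostOneTwo? xs = (mult 1 xs ≟ 0) ×-dec (mult 2 xs ≤? 1)

-- Without a 2 all parts are at least 3. With exactly one 2, its removal leaves such a partition,
-- which accounts for the factor q².
count-atMostOneTwo : count atMostOneTwo? ≗ count≥ 3 ⊞ shift 2 (count≥ 3)
count-atMostOneTwo m = trans (cong +_ split) (cong (count≥ 3 m ⊕_)
  (count-remove P? (parts≥? 3) 2 P-resp-↭ P⇒∈ P∷⇔ m))
  where
  P : List ℕ → Set
  P xs = mult 1 xs ≡ 0 × mult 2 xs ≡ 1

  P? : Decidable P
  P? xs = (mult 1 xs ≟ 0) ×-dec (mult 2 xs ≟ 1)

  P-resp-↭ : P Respects _↭_
  P-resp-↭ xs↭ys (h₁ , h₂) =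
    trans (sym (mult-resp-↭ 1 xs↭ys)) h₁ , trans (sym (mult-resp-↭ 2 xs↭ys)) h₂

  P⇒∈ : ∀ {xs} → P xs → 2 ∈ xs
  P⇒∈ {xs} (_ , h) = mult≢0⇒∈ 2 xs λ h′ → ℕ.1+n≢0 (trans (sym h) h′)

  noOneTwo : ∀ {xs} → All (1 ≤_) xs → mult 1 xs ≡ 0 → mult 2 xs ≡ 0 → All (3 ≤_) xs
  noOneTwo pos h₁ h₂ = All≤∧mult≡0⇒All< 2 (All≤∧mult≡0⇒All< 1 pos h₁) h₂

  mult1≡0 : ∀ {xs} → All (3 ≤_) xs → mult 1 xs ≡ 0
  mult1≡0 = All<⇒mult≡0 1 ∘ All.map ℕ.<⇒≤

  P∷⇔ : ∀ {ys} → All (1 ≤_) ys → P (2 ∷ ys) ⇔ All (3 ≤_) ys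
  -- With the numeral 2 in front, `mult 1` and `mult 2` compute to `mult 1 ys` and
  -- `suc (mult 2 ys)`.
  P∷⇔ pos = mk⇔
    (λ (h₁ , h₂) → noOneTwo pos h₁ (ℕ.suc-injective h₂))
    (λ 3≤ys → mult1≡0 3≤ys , cong suc (All<⇒mult≡0 2 3≤ys))

  split : length (filter atMostOneTwo? (partitions m)) ≡
          length (filter (parts≥? 3) (partitions m)) + length (filter P? (partitions m))
  split = length-filter-⊎ (parts≥? 3) P? atMostOneTwo? (partitions m)
    (λ {xs} xs∈ → cases xs (positive (to (∈-partitions {m}) xs∈)))
    (λ _ 3≤xs → (mult1≡0 3≤xs , ℕ.≤-trans (ℕ.≤-reflexive (All<⇒mult≡0 2 3≤xs)) z≤n)
              , λ (_ , h) → ℕ.1+n≢0 (trans (sym h) (All<⇒mult≡0 2 3≤xs)))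
    (λ _ (h₁ , h₂) → h₁ , ℕ.≤-reflexive h₂)
    where
    cases : ∀ xs → All (1 ≤_) xs → AtMostOneTwo xs → All (3 ≤_) xs ⊎ P xs
    cases xs pos (h₁ , h₂) with ℕ.m≤n⇒m<n∨m≡n h₂
    ... | inj₁ h = inj₁ (noOneTwo pos h₁ (ℕ.n≤0⇒n≡0 (ℕ.≤-pred h)))
    ... | inj₂ h = inj₂ (h₁ , h)

-- Raising the largest part.

Unrepeated : List ℕ → Set
Unrepeated xs = AtMostOneTwo xs × ¬ RepeatedLargest xs

unrepeated? : Decidable Unrepeated
unrepeated? xs = atMostOneTwo? xs ×-dec ¬? (mult (max 0 xs) xs >? 1)

-- The head of a decreasing list is its largest part. The value at `[]` is a dummy, as only
-- partitions of n ≥ 5 are raised.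
raiseHead : List ℕ → List ℕ
raiseHead []       = []
raiseHead (x ∷ xs) = suc x ∷ xs

raiseHead-injective : ∀ {xs ys} → raiseHead xs ≡ raiseHead ys → xs ≡ ys
raiseHead-injective {[]}    {[]}    _    = refl
raiseHead-injective {_ ∷ _} {_ ∷ _} refl = refl

head-≥ : ∀ {x xs} → Linked _≥_ (x ∷ xs) → All (_≤ x) xs
head-≥ = All.tail ∘ Linked⇒All (λ x≥y y≥z → ℕ.≤-trans y≥z x≥y) ℕ.≤-refl

replace-head : ∀ {x y xs} → Linked _≥_ (x ∷ xs) → All (_≤ y) xs → Linked _≥_ (y ∷ xs)
replace-head [-]      []        = [-]
replace-head (_ ∷ lk) (z≤y ∷ _) = z≤y ∷ lk

-- The maximum of a decreasing list is its head x, so its multiplicity exceeds 1 exactly when x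
-- occurs again in the tail, whose entries are all at most x.
¬repeatedLargest⇔ : ∀ {x xs} → Linked _≥_ (x ∷ xs) → (¬ RepeatedLargest (x ∷ xs)) ⇔ All (_< x) xs
¬repeatedLargest⇔ {x} {xs} lk
  rewrite max≈v⁺ {⊤ = 0} (here {xs = xs} refl) (ℕ.≤-refl ∷ head-≥ lk) z≤n | mult-≡ x xs = mk⇔
  (λ ¬rep → All.zipWith (λ (y≤x , y≢x) → ℕ.≤∧≢⇒< y≤x y≢x)
    (head-≥ lk , mult≡0⇒All≢ x xs (ℕ.n≤0⇒n≡0 (ℕ.≤-pred (ℕ.≮⇒≥ ¬rep)))))
  (λ xs<x rep → ℕ.<⇒≱ rep (s≤s (ℕ.≤-reflexive (All≢⇒mult≡0 x (All.map ℕ.<⇒≢ xs<x)))))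

-- Lowering the largest part of 3 + 2 would create a second 2, hence the bound on n.
4≤largest : ∀ {n y xs} → 6 ≤ n → IsPartition n (y ∷ xs) → AtMostOneTwo (y ∷ xs) →
            All (_< y) xs → 4 ≤ y
4≤largest {n} {y} {xs} 6≤n (isPartition lk pos refl) (h₁ , h₂) xs<y =
  ℕ.≰⇒> λ y≤3 → small y≤3 xs lk pos h₁ h₂ xs<y 6≤n
  where
  two : ∀ z → 1 ≤ z → z ≤ 2 → z ≢ 1 → z ≡ 2
  two 1 _ _ z≢1 = contradiction refl z≢1
  two 2 _ _ _   = refl
  two (suc (suc (suc _))) _ (s≤s (s≤s ())) _

  -- The parts after y are at most 2. A single one gives a sum of at most 3 + 2 = 5; two of them,
  -- not being 1, are two 2s.
  small : ∀ {y} → y ≤ 3 → ∀ xs → Linked _≥_ (y ∷ xs) → All (1 ≤_) (y ∷ xs) →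
          mult 1 (y ∷ xs) ≡ 0 → mult 2 (y ∷ xs) ≤ 1 → All (_< y) xs → ¬ (6 ≤ sum (y ∷ xs))
  small {y} y≤3 [] _ _ _ _ _ 6≤ = ℕ.<⇒≱ (s≤s (ℕ.+-monoˡ-≤ 0 y≤3)) (ℕ.≤-trans (ℕ.m≤n+m 4 2) 6≤)
  small {y} y≤3 (z ∷ []) _ _ _ _ (z<y ∷ []) 6≤ = ℕ.<⇒≱
    (s≤s (ℕ.+-mono-≤ y≤3 (ℕ.+-monoˡ-≤ 0 (ℕ.≤-pred (ℕ.≤-trans z<y y≤3))))) 6≤
  small {y} y≤3 (z ∷ w ∷ ws) (_ ∷ w≤z ∷ _) (_ ∷ 1≤z ∷ 1≤w ∷ _) h₁ h₂ (z<y ∷ _) _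
    with zw≢1 ← mult≡0⇒All≢ 1 (y ∷ z ∷ w ∷ ws) h₁
    with refl ← two z 1≤z (ℕ.≤-pred (ℕ.≤-trans z<y y≤3)) (All.head (All.tail zw≢1))
    with refl ← two w 1≤w w≤z (All.head (All.tail (All.tail zw≢1)))
    = ℕ.<⇒≱ (s≤s (s≤s z≤n)) (ℕ.≤-trans (mult-tail-≤ 2 y (2 ∷ 2 ∷ ws)) h₂)

-- Raising the head makes it exceed all other parts. Conversely a head that exceeds all others can
-- be lowered without breaking the order, and by `4≤largest` it stays at least 3, so no 1 or 2 is
-- created.
filter-unrepeated-↭ : ∀ n → 5 ≤ n →
  filter unrepeated? (partitions (suc n)) ↭
  map raiseHead (filter atMostOneTwo? (partitions n))
filter-unrepeated-↭ n 5≤n = unique⇔⇒↭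
  (Unique.filter⁺ unrepeated? (partitions-unique (suc n)))
  (Unique.map⁺ raiseHead-injective (Unique.filter⁺ atMostOneTwo? (partitions-unique n)))
  lowered raised
  where
  lower : ∀ xs → IsPartition (suc n) xs → Unrepeated xs →
          ∃ λ ys → IsPartition n ys × AtMostOneTwo ys × xs ≡ raiseHead ys
  lower (y ∷ xs) y∷xs-part@(isPartition lk (_ ∷ pos) tot) (h , ¬rep)
    with xs<y ← to (¬repeatedLargest⇔ lk) ¬rep
    -- This exposes y as 4 + x. Neither 4 + x nor 3 + x is 1 or 2, so the conditions for both lists
    -- compute to those for `xs`, and `h` serves for both.
    with s≤s (s≤s (s≤s (s≤s {n = x} z≤n))) ← 4≤largest (s≤s 5≤n) y∷xs-part h xs<y
    = 3 + x ∷ xs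
    , isPartition (replace-head lk (All.map ℕ.≤-pred xs<y)) (s≤s z≤n ∷ pos) (ℕ.suc-injective tot)
    , h , refl

  lowered : ∀ {xs} → xs ∈ filter unrepeated? (partitions (suc n)) →
            xs ∈ map raiseHead (filter atMostOneTwo? (partitions n))
  lowered {xs} xs∈ with xs∈ps , unrep ← ∈-filter⁻ unrepeated? {xs = partitions (suc n)} xs∈
    with ys , ys-part , h′ , refl ← lower xs (to ∈-partitions xs∈ps) unrep
    = ∈-map⁺ raiseHead (∈-filter⁺ atMostOneTwo? (from ∈-partitions ys-part) h′)

  raise : ∀ xs → IsPartition n xs → AtMostOneTwo xs →
          IsPartition (suc n) (raiseHead xs) × Unrepeated (raiseHead xs)
  raise [] (isPartition _ _ refl) _ = contradiction 5≤n λ ()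
  raise (1 ∷ xs) _ (() , _)
  raise (suc (suc x) ∷ xs) (isPartition lk (_ ∷ pos) tot) (h₁ , h₂) =
    isPartition lk′ (s≤s z≤n ∷ pos) (cong suc tot) ,
    -- The new head 3 + x is neither 1 nor 2, so the number of 2s can only drop.
    (h₁ , ℕ.≤-trans (mult-tail-≤ 2 (2 + x) xs) h₂) ,
    from (¬repeatedLargest⇔ lk′) (All.map s≤s (head-≥ lk))
    where lk′ = replace-head lk (All.map ℕ.m≤n⇒m≤1+n (head-≥ lk))
  raise (zero ∷ xs) (isPartition _ (() ∷ _) _) _

  raised : ∀ {xs} → xs ∈ map raiseHead (filter atMostOneTwo? (partitions n)) →
           xs ∈ filter unrepeated? (partitions (suc n))
  raised xs∈ with ys , ys∈ , refl ← ∈-map⁻ raiseHead xs∈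
    with ys∈ps , h ← ∈-filter⁻ atMostOneTwo? {xs = partitions n} ys∈
    with part , unrep ← raise ys (to ∈-partitions ys∈ps) h
    = ∈-filter⁺ unrepeated? (from ∈-partitions part) unrep

-- The admissible partitions are what the unrepeated ones leave over, and the latter are
-- equinumerous with the `AtMostOneTwo` partitions of n.
#admissible-suc : ∀ n → 5 ≤ n → + #admissible (suc n) ≡ Δ 1 (count atMostOneTwo?) (suc n)
#admissible-suc n 5≤n = begin
  + #admissible (suc n)
    ≡⟨ cancel (+ #admissible (suc n)) (count unrepeated? (suc n)) ⟩
  (+ #admissible (suc n) ⊕ count unrepeated? (suc n)) - count unrepeated? (suc n)
    ≡⟨ cong₂ _-_ (cong +_ (sym split))
         (cong +_ (trans (↭-length (filter-unrepeated-↭ n 5≤n))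
                         (length-map raiseHead (filter atMostOneTwo? (partitions n))))) ⟩
  count atMostOneTwo? (suc n) - count atMostOneTwo? n ∎
  where
  open ≡-Reasoning
  cancel : ∀ a b → a ≡ (a ⊕ b) - b
  cancel = solve-∀
  split : length (filter atMostOneTwo? (partitions (suc n))) ≡
          #admissible (suc n) + length (filter unrepeated? (partitions (suc n)))
  split = length-filter-⊎ admissible? unrepeated? atMostOneTwo? (partitions (suc n))
    (λ {xs} _ → cases xs)
    (λ _ (h₁ , h₂ , rep) → (h₁ , h₂) , λ (_ , ¬rep) → ¬rep rep)
    (λ _ → proj₁)
    where
    cases : ∀ xs → AtMostOneTwo xs →
            Admissible xs ⊎ Unrepeated xs
    cases xs h@(h₁ , h₂) with mult (max 0 xs) xs >? 1
    ... | yes rep = inj₁ (h₁ , h₂ , rep)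
    ... | no ¬rep = inj₂ (h , ¬rep)

-- Generating functions of the two counts

∑≡∑< : ∀ a b f → ∑[ a ⋯ b ] f ≡ ∑< (suc b ∸ a) (λ i → f (a + i))
∑≡∑< a b f = trans (cong (foldr _⊕_ 0ℤ) (map-upTo (λ i → f (a + i)) (suc b ∸ a)))
                   (applied (suc b ∸ a) (λ i → f (a + i)))
  where
  applied : ∀ n f → foldr _⊕_ 0ℤ (applyUpTo f n) ≡ ∑< n f
  applied zero    f = refl
  applied (suc n) f = cong (f 0 ⊕_) (applied n (f ∘ suc))

-- The argument 2 + n keeps the subtractions in `∇` untruncated.
∇²≡ : ∀ f n → ∇ 2 f (2 + n) ≡ (f (2 + n) - f (1 + n)) - (f (1 + n) - f n)
∇²≡ f n = expand (f (2 + n)) (f (1 + n)) (f n)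
  where
  expand : ∀ a b c → 1ℤ * 1ℤ * a ⊕ (-1ℤ * + 2 * b ⊕ (1ℤ * 1ℤ * c ⊕ 0ℤ)) ≡ (a - b) - (b - c)
  expand = solve-∀

∇²-∇²≡ : ∀ f n → ∇ 2 f (6 + n) - ∇ 2 f (2 + n) ≡ Δ 1 (Δ 1 (Δ 4 f)) (6 + n)
∇²-∇²≡ f n = trans (cong₂ _-_ (∇²≡ f (4 + n)) (∇²≡ f n))
  (regroup (f (6 + n)) (f (5 + n)) (f (4 + n)) (f (2 + n)) (f (1 + n)) (f n))
  where
  regroup : ∀ a b c x y z → ((a - b) - (b - c)) - ((x - y) - (y - z)) ≡
            ((a - x) - (b - y)) - ((b - y) - (c - z))
  regroup = solve-∀

-- (1 + q^k)(1 - q^k) = 1 - q^(2k).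
Δ-double : ∀ k f → Δ k f ⊞ shift k (Δ k f) ≗ Δ (k + k) f
Δ-double k f m
  rewrite shift-distrib-- k f (shift k f) m | shift-shift k k f m
  = telescope (f m) (shift k f m) (shift (k + k) f m)
  where
  telescope : ∀ a b c → (a - b) ⊕ (b - c) ≡ a - c
  telescope = solve-∀

-- Exchanging the sums gives f (n - d) the weight ∑_{k∣d} μ(k), which vanishes unless d = 1. So only
-- f (n - 1) = f m survives.
∑μ-geometric : ∀ f m → ∑< (suc m) (λ j → geometric f (suc j) (suc m) * μ (suc j)) ≡ f m
∑μ-geometric f m = begin
  ∑< n (λ j → geometric f (suc j) n * μ (suc j))
    ≡⟨ ∑<-cong n (λ j _ → trans (ℤ.*-comm (geometric f (suc j) n) (μ (suc j)))
         (*-distribˡ-∑< n (μ (suc j)) (λ i → ⟦ suc j ∣? suc i ⟧ * f (n ∸ suc i)))) ⟩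
  ∑< n (λ j → ∑< n (λ i → term j i))
    ≡⟨ ∑<-comm n n term ⟩
  ∑< n (λ i → ∑< n (λ j → term j i))
    ≡⟨ ∑<-cong n (λ i i<n → trans
         (∑<-cong n λ j _ → rearrange (μ (suc j)) ⟦ suc j ∣? suc i ⟧ (f (n ∸ suc i)))
         (sym (*-distribˡ-∑< n (f (n ∸ suc i)) (divisor-term i)))) ⟩
  ∑< n (λ i → f (n ∸ suc i) * ∑< n (divisor-term i))
    -- No k > d divides d, so the inner sum may stop at d = i + 1, where it is the divisor sum
    -- `∑∣μ`.
    ≡⟨ ∑<-cong n (λ i i<n → cong (f (n ∸ suc i) *_) (∑<-truncate i<n {divisor-term i} λ j 1+i≤j →
         ⟦⟧-false-* (suc j ∣? suc i) (μ (suc j)) λ 1+j∣1+i → ℕ.<⇒≱ (s≤s 1+i≤j) (∣⇒≤ 1+j∣1+i))) ⟩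
  ∑< n (λ i → f (n ∸ suc i) * ∑∣μ (suc i))
    ≡⟨⟩
  f m * ∑∣μ 1 ⊕ ∑< m (λ i → f (m ∸ suc i) * ∑∣μ (2 + i))
    ≡⟨ cong₂ _⊕_ (cong (f m *_) ∑∣μ[1]≡1)
         (∑<-zero m λ i _ → trans (cong (f (m ∸ suc i) *_) (∑∣μ≡0 (2 + i))) (ℤ.*-zeroʳ (f (m ∸ suc i)))) ⟩
  f m * 1ℤ ⊕ 0ℤ
    ≡⟨ trans (ℤ.+-identityʳ _) (ℤ.*-identityʳ (f m)) ⟩
  f m ∎
  where
  open ≡-Reasoning
  n = suc m
  term : ℕ → ℕ → ℤ
  term j i = μ (suc j) * (⟦ suc j ∣? suc i ⟧ * f (n ∸ suc i))
  divisor-term : ℕ → ℕ → ℤ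
  divisor-term i j = ⟦ suc j ∣? suc i ⟧ * μ (suc j)
  rearrange : ∀ a b c → a * (b * c) ≡ c * (b * a)
  rearrange = solve-∀
  ∑∣μ[1]≡1 : ∑∣μ 1 ≡ 1ℤ
  ∑∣μ[1]≡1 = cong (λ x → 1ℤ * x ⊕ 0ℤ) μ[1]≡1

μ-prime : ∀ {q} → Prime q → μ q ≡ -1ℤ
μ-prime {q} q-prime = begin
  μ q         ≡⟨ cong μ (ℕ.*-identityʳ q) ⟨
  μ (q ℕ.* 1) ≡⟨ μ-prime-*-∤ q-prime (λ q∣1 → prime≢1 q-prime (∣1⇒≡1 q∣1)) ⟩
  - μ 1       ≡⟨ cong -_ μ[1]≡1 ⟩
  -1ℤ         ∎
  where
  open ≡-Reasoning
  prime≢1 : Prime q → q ≢ 1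
  prime≢1 q-prime refl = ¬prime[1] q-prime

μ[4]≡0 : μ 4 ≡ 0ℤ
μ[4]≡0 = μ-prime-*-∣ {2} {2} (from-yes (prime? 2)) ∣-refl

p̂ Δ₄p : ℕ → ℤ
p̂ m = + p m
Δ₄p = Δ 4 p̂

count≥3 : count≥ 3 ≗ Δ 2 (Δ 1 p̂)
count≥3 m = trans (count≥-suc 2 m) (Δ-cong 2 (λ i → trans (count≥-suc 1 i) (Δ-cong 1 count≥1 i)) m)

-- The factor 1 - q⁴ is moved innermost: both sides of the final identity share it, so `Δ₄p` can be
-- treated there as an arbitrary series.
count≥5 : count≥ 5 ≗ Δ 3 (Δ 2 (Δ 1 Δ₄p))
count≥5 m = begin
  count≥ 5 m                  ≡⟨ count≥-suc 4 m ⟩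
  Δ 4 (count≥ 4) m            ≡⟨ Δ-cong 4 (count≥-suc 3) m ⟩
  Δ 4 (Δ 3 (count≥ 3)) m      ≡⟨ Δ-comm 4 3 (count≥ 3) m ⟩
  Δ 3 (Δ 4 (count≥ 3)) m      ≡⟨ Δ-cong 3 (Δ-cong 4 count≥3) m ⟩
  Δ 3 (Δ 4 (Δ 2 (Δ 1 p̂))) m   ≡⟨ Δ-cong 3 (Δ-comm 4 2 (Δ 1 p̂)) m ⟩
  Δ 3 (Δ 2 (Δ 4 (Δ 1 p̂))) m   ≡⟨ Δ-cong 3 (Δ-cong 2 (Δ-comm 4 1 p̂)) m ⟩
  Δ 3 (Δ 2 (Δ 1 Δ₄p)) m         ∎
  where
  open ≡-Reasoning

#admissible≡ : ∀ n → + #admissible (6 + n) ≡ Δ 1 (Δ 1 Δ₄p) (6 + n)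
#admissible≡ n = trans (#admissible-suc (5 + n) (ℕ.m≤m+n 5 n)) (Δ-cong 1 series (6 + n))
  where
  open ≡-Reasoning
  series : count atMostOneTwo? ≗ Δ 1 Δ₄p
  series m = begin
    count atMostOneTwo? m                     ≡⟨ count-atMostOneTwo m ⟩
    count≥ 3 m ⊕ shift 2 (count≥ 3) m         ≡⟨ cong₂ _⊕_ (count≥3 m) (shift-cong 2 count≥3 m) ⟩
    (Δ 2 (Δ 1 p̂) ⊞ shift 2 (Δ 2 (Δ 1 p̂))) m   ≡⟨ Δ-double 2 (Δ 1 p̂) m ⟩
    Δ 4 (Δ 1 p̂) m                             ≡⟨ Δ-comm 4 1 p̂ m ⟩
    Δ 1 Δ₄p m                                   ∎

geometric-closed : ∀ k .{{_ : NonZero k}} f h → f ≗ Δ k h → geometric f k ≗ shift k h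
geometric-closed k f h f≗Δh =
  shift-fixpoint-unique k f (geometric-fixpoint k f) (shift-fixpoint k f≗Δh)

-- Both sides solve the same fixpoint equation.
S≡geometric : ∀ r k .{{_ : NonZero k}} m → r ≤ k → + S r m k ≡ geometric (count≥ r) k m
S≡geometric r k m r≤k = shift-fixpoint-unique k (count≥ r)
  (Containing.S-fixpoint r k r≤k) (geometric-fixpoint k (count≥ r)) m

-- Extending the sum to all k ≥ 1 makes `∑μ-geometric` applicable. The added terms have closed forms
-- because 1 - q, 1 - q² and 1 - q³ are factors of the series `count≥ 5`.
∑Sμ : ∀ t → ∑< (3 + t) (λ i → + S 5 (7 + t) (5 + i) * μ (5 + i)) ≡ - Δ 1 (Δ 1 Δ₄p) (2 + t)
∑Sμ t = begin
  ∑< (3 + t) (λ i → + S 5 m (5 + i) * μ (5 + i))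
    ≡⟨ ∑<-cong (3 + t) (λ i _ → cong (_* μ (5 + i)) (S≡geometric 5 (5 + i) m (ℕ.m≤m+n 5 i))) ⟩
  tail
    -- The weights 1, -1, -1, 0 are μ(1), ..., μ(4). For k < 5, `g k` is a coefficient of the formal
    -- series and not a value of `S`, which is 0 there.
    ≡⟨ isolate (g 1) (g 2) (g 3) (g 4) tail ⟩
  (g 1 * 1ℤ ⊕ (g 2 * -1ℤ ⊕ (g 3 * -1ℤ ⊕ (g 4 * 0ℤ ⊕ tail)))) - g 1 ⊕ g 2 ⊕ g 3
    ≡⟨ cong (λ x → x - g 1 ⊕ g 2 ⊕ g 3) all-terms ⟩
  count≥ 5 (6 + t) - g 1 ⊕ g 2 ⊕ g 3
    ≡⟨ cong₂ _⊕_ (cong₂ _⊕_ (cong₂ _-_ (count≥5 (6 + t))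
         (geometric-closed 1 (count≥ 5) (Δ 3 (Δ 2 Δ₄p)) count≥5-1 m))
         (geometric-closed 2 (count≥ 5) (Δ 3 (Δ 1 Δ₄p)) count≥5-2 m))
         (geometric-closed 3 (count≥ 5) (Δ 2 (Δ 1 Δ₄p)) count≥5 m) ⟩
  Δ 3 (Δ 2 (Δ 1 Δ₄p)) (6 + t) - shift 1 (Δ 3 (Δ 2 Δ₄p)) m
    ⊕ shift 2 (Δ 3 (Δ 1 Δ₄p)) m ⊕ shift 3 (Δ 2 (Δ 1 Δ₄p)) m
    ≡⟨ polynomial-identity Δ₄p t ⟩
  - Δ 1 (Δ 1 Δ₄p) (2 + t) ∎
  where
  open ≡-Reasoning
  m = 7 + t
  g : ℕ → ℤ
  g k = geometric (count≥ 5) k m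
  tail : ℤ
  tail = ∑< (3 + t) (λ i → g (5 + i) * μ (5 + i))

  isolate : ∀ a b c d x →
    x ≡ (a * 1ℤ ⊕ (b * -1ℤ ⊕ (c * -1ℤ ⊕ (d * 0ℤ ⊕ x)))) - a ⊕ b ⊕ c
  isolate = solve-∀

  all-terms : g 1 * 1ℤ ⊕ (g 2 * -1ℤ ⊕ (g 3 * -1ℤ ⊕ (g 4 * 0ℤ ⊕ tail))) ≡ count≥ 5 (6 + t)
  -- The first four of the 7 + t terms split off by computation, leaving `tail`.
  all-terms = trans
    (sym (cong₂ _⊕_ (cong (g 1 *_) μ[1]≡1)
         (cong₂ _⊕_ (cong (g 2 *_) (μ-prime (from-yes (prime? 2))))
         (cong₂ _⊕_ (cong (g 3 *_) (μ-prime (from-yes (prime? 3))))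
         (cong (λ x → g 4 * x ⊕ tail) μ[4]≡0)))))
    (∑μ-geometric (count≥ 5) (6 + t))

  count≥5-2 : count≥ 5 ≗ Δ 2 (Δ 3 (Δ 1 Δ₄p))
  count≥5-2 i = trans (count≥5 i) (Δ-comm 3 2 (Δ 1 Δ₄p) i)

  count≥5-1 : count≥ 5 ≗ Δ 1 (Δ 3 (Δ 2 Δ₄p))
  count≥5-1 i = trans (count≥5 i)
    (trans (Δ-cong 3 (Δ-comm 2 1 Δ₄p) i) (Δ-comm 3 1 (Δ 2 Δ₄p) i))

corollary1p7 : ∀ (n : ℕ) → 6 ≤ n →
    (+ #admissible n ≡ ∇ 2 (λ m → + p m) n - ∇ 2 (λ m → + p m) (n ∸ 4)) ×
    (∇ 2 (λ m → + p m) n - ∇ 2 (λ m → + p m) (n ∸ 4)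
    ≡ - ∑[ 5 ⋯ n + 5 ] (λ k → + S 5 (n + 5) k * μ k))
-- Writing n as 6 + t lets n ∸ 4 compute to 2 + t.
corollary1p7 n 6≤n with position 6 n
... | below n<6 = contradiction n<6 (ℕ.≤⇒≯ 6≤n)
... | above t refl = first , second
  where
  ∇²≡Δ : ∇ 2 p̂ (6 + t) - ∇ 2 p̂ (2 + t) ≡ Δ 1 (Δ 1 Δ₄p) (6 + t)
  ∇²≡Δ = ∇²-∇²≡ p̂ t

  first : + #admissible (6 + t) ≡ ∇ 2 p̂ (6 + t) - ∇ 2 p̂ (2 + t)
  first = trans (#admissible≡ t) (sym ∇²≡Δ)

  second : ∇ 2 p̂ (6 + t) - ∇ 2 p̂ (2 + t)
           ≡ - ∑[ 5 ⋯ 6 + t + 5 ] (λ k → + S 5 (6 + t + 5) k * μ k)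
  -- Now 6 + t + 5 computes to 11 + t = 7 + (4 + t), and the sum from 5 has 7 + t = 3 + (4 + t)
  -- terms, as in `∑Sμ (4 + t)`.
  second rewrite ℕ.+-comm t 5 = begin
    ∇ 2 p̂ (6 + t) - ∇ 2 p̂ (2 + t)
      ≡⟨ ∇²≡Δ ⟩
    Δ 1 (Δ 1 Δ₄p) (6 + t)
      ≡⟨ ℤ.neg-involutive (Δ 1 (Δ 1 Δ₄p) (6 + t)) ⟨
    - - Δ 1 (Δ 1 Δ₄p) (6 + t)
      ≡⟨ cong -_ (trans (∑≡∑< 5 (11 + t) (λ k → + S 5 (11 + t) k * μ k)) (∑Sμ (4 + t))) ⟨
    - ∑[ 5 ⋯ 11 + t ] (λ k → + S 5 (11 + t) k * μ k) ∎
    where open ≡-Reasoning
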